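{- Let $f,g:\{0,1\}^n\to\{0,1\}$ be Boolean functions. (1) If $f$ and $g$ are unbalanced and $f$ is PN-equivalent to $g$, then $OSDV(f)=OSDV(g)$, $OSDV^0(f)=OSDV^0(g)$ and $OSDV^1(f)=OSDV^1(g)$. (2) If $f$ and $g$ are balanced and $f$ is NPN-equivalent to $g$, then either ($OSDV^1(f)=OSDV^1(g)$ and $OSDV^0(f)=OSDV^0(g)$) or ($OSDV^1(f)=OSDV^0(g)$ and $OSDV^0(f)=OSDV^1(g)$).
   Context: For a word $X=(x_1,\dots,x_n)\in\{0,1\}^n$, $X^i$ denotes $X$ with its $i$-th bit negated. A selective negation $(\neg)$ is a map $\{0,1\}^n\to\{0,1\}^n$ that negates the bits in some fixed set of positions and leaves the others unchanged. A permutation $\pi$ acts on words by reordering their entries. $f$ is PN-equivalent to $g$ if there are a permutation $\pi$ and a selective negation $(\neg)$ with $f(\pi((\neg)X))=g(X)$ for all $X\in\{0,1\}^n$. $f$ is NPN-equivalent to $g$ if there are $\pi$ and $(\neg)$ such that either $f(\pi((\neg)X))=g(X)$ for all $X$, or $\neg f(\pi((\neg)X))=g(X)$ for all $X$. A function $f$ on $n$ variables is balanced if $|f^{ -1}(1)|=|f^{ -1}(0)|=2^{n-1}$, and unbalanced otherwise. The local sensitivity of $f$ at $X$ is $sen(f,X)=|\{i\in\{1,\dots,n\}: f(X)\neq f(X^i)\}|$. $h(X,Y)$ is the Hamming distance between the words $X$ and $Y$. The ordered sensitivity distance vector is $OSDV(f)=(\sigma_0,\sigma_1,\dots,\sigma_n)$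 with $\sigma_i=(\delta_{i1},\dots,\delta_{in})$ and $$\delta_{ij}=|\{(X,Y)\in\{0,1\}^n\times\{0,1\}^n : sen(f,X)=sen(f,Y)=i,\ h(X,Y)=j,\ X<Y\}|,$$ where $X<Y$ compares words as binary integers (so each unordered pair is counted once). For $b\in\{0,1\}$, $OSDV^b(f)$ is defined in the same way, but counting only pairs $(X,Y)$ with $f(X)=f(Y)=b$. -}

module Defs where

open import Data.Bool using (Bool; true; false; not; if_then_else_)
open import Data.Bool.Properties using () renaming (_≟_ to _≟ᵇ_)
open import Data.Fin using (Fin; toℕ)
open import Data.Fin.Permutation using (Permutation′; _⟨$⟩ʳ_)
open import Data.Fin.Subset using (Subset)
open import Data.List using (List; []; _∷_; length; filter; allFin; cartesianProduct; cartesianProductWith)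
open import Data.List.Membership.Propositional using (_∈_)
open import Data.List.Membership.Propositional.Properties using (∈-cartesianProductWith⁺)
open import Data.List.Relation.Unary.All using ([]; _∷_)
open import Data.List.Relation.Unary.AllPairs using ([]; _∷_)
open import Data.List.Relation.Unary.Any using (here; there)
open import Data.List.Relation.Unary.Unique.Propositional using (Unique)
open import Data.List.Relation.Unary.Unique.Propositional.Properties using (cartesianProductWith⁺)
open import Data.Nat using (ℕ; zero; suc; _+_; _∸_; _^_)
open import Data.Nat.Properties using (_≟_; _<?_)
open import Data.Product using (_×_; _,_; ∃-syntax)
open import Data.Sum using (_⊎_)
open import Data.Vec using (Vec; []; _∷_; lookup; tabulate; zipWith; updateAt)
open import Data.Vec.Properties using (∷-injective)
open import Relation.Binary.PropositionalEquality using (_≡_; refl)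
open import Relation.Nullary using (¬_; ¬?; _×-dec_)
open import Relation.Unary using (Pred; Decidable)

Word : ℕ → Set
Word n = Vec Bool n

BooleanFunction : ℕ → Set
BooleanFunction n = Word n → Bool

bools : List Bool
bools = false ∷ true ∷ []

words : ∀ n → List (Word n)
words zero    = [] ∷ []
words (suc n) = cartesianProductWith _∷_ bools (words n)

-- words-complete and words-unique justify reading counts over `words n`
-- as cardinalities of subsets of {0,1}ⁿ.
words-complete : ∀ {n} (X : Word n) → X ∈ words n
words-complete []          = here refl
words-complete (false ∷ X) = ∈-cartesianProductWith⁺ _∷_ {xs = bools} (here refl) (words-complete X)
words-complete (true ∷ X)  = ∈-cartesianProductWith⁺ _∷_ {xs = bools} (there (here refl)) (words-complete X)

words-unique : ∀ n → Unique (words n)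
words-unique zero    = [] ∷ []
words-unique (suc n) =
  cartesianProductWith⁺ _∷_ ∷-injective (((λ ()) ∷ []) ∷ [] ∷ []) (words-unique n)

count : ∀ {a p} {A : Set a} {P : Pred A p} → Decidable P → List A → ℕ
count P? xs = length (filter P? xs)

flip : ∀ {n} → Word n → Fin n → Word n
flip X i = updateAt X i not

-- The set of negated positions is the `Subset n` argument.
selectiveNegation : ∀ {n} → Subset n → Word n → Word n
selectiveNegation = zipWith (λ s x → if s then not x else x)

permute : ∀ {n} → Permutation′ n → Word n → Word n
permute π X = tabulate (λ i → lookup X (π ⟨$⟩ʳ i))

PNEquivalent : ∀ {n} → BooleanFunction n → BooleanFunction n → Set
PNEquivalent {n} f g =
  ∃[ π ] ∃[ S ] (∀ (X : Word n) → f (permute π (selectiveNegation S X)) ≡ g X)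

NPNEquivalent : ∀ {n} → BooleanFunction n → BooleanFunction n → Set
NPNEquivalent {n} f g =
  ∃[ π ] ∃[ S ] ( (∀ (X : Word n) → f (permute π (selectiveNegation S X)) ≡ g X)
                ⊎ (∀ (X : Word n) → not (f (permute π (selectiveNegation S X))) ≡ g X))

∣_⁻¹_∣ : ∀ {n} → BooleanFunction n → Bool → ℕ
∣_⁻¹_∣ {n} f b = count (λ X → f X ≟ᵇ b) (words n)

-- For n = 0 the truncated exponent is harmless: the two preimages of a
-- function on one point never have equal size, so it is unbalanced.
Balanced : ∀ {n} → BooleanFunction n → Set
Balanced {n} f = ∣ f ⁻¹ true ∣ ≡ 2 ^ (n ∸ 1) × ∣ f ⁻¹ false ∣ ≡ 2 ^ (n ∸ 1)

Unbalanced : ∀ {n} → BooleanFunction n → Set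
Unbalanced f = ¬ Balanced f

sen : ∀ {n} → BooleanFunction n → Word n → ℕ
sen {n} f X = count (λ i → ¬? (f X ≟ᵇ f (flip X i))) (allFin n)

hamming : ∀ {n} → Word n → Word n → ℕ
hamming {n} X Y = count (λ i → ¬? (lookup X i ≟ᵇ lookup Y i)) (allFin n)

-- The first entry is the most significant bit.
binary : ∀ {n} → Word n → ℕ
binary []              = 0
binary {suc n} (x ∷ X) = (if x then 2 ^ n else 0) + binary X

δ : ∀ {n} → BooleanFunction n → ℕ → ℕ → ℕ
δ {n} f i j =
  count (λ (X , Y) → (sen f X ≟ i) ×-dec (sen f Y ≟ i)
                     ×-dec (hamming X Y ≟ j) ×-dec (binary X <? binary Y))
        (cartesianProduct (words n) (words n))

δᵇ : ∀ {n} → Bool → BooleanFunction n → ℕ → ℕ → ℕ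
δᵇ {n} b f i j =
  count (λ (X , Y) → (f X ≟ᵇ b) ×-dec (f Y ≟ᵇ b)
                     ×-dec (sen f X ≟ i) ×-dec (sen f Y ≟ i)
                     ×-dec (hamming X Y ≟ j) ×-dec (binary X <? binary Y))
        (cartesianProduct (words n) (words n))

-- Rows are indexed by i = 0,…,n and columns by j = 1,…,n; the `suc` shifts
-- the column index.
OSDV : ∀ {n} → BooleanFunction n → Vec (Vec ℕ n) (suc n)
OSDV f = tabulate (λ i → tabulate (λ j → δ f (toℕ i) (suc (toℕ j))))

OSDVᵇ : ∀ {n} → Bool → BooleanFunction n → Vec (Vec ℕ n) (suc n)
OSDVᵇ b f = tabulate (λ i → tabulate (λ j → δᵇ b f (toℕ i) (suc (toℕ j))))

{-# OPTIONS --safe #-}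

-- A PN-transformation T is a bijection of the cube which preserves Hamming
-- distance and carries edges to edges, hence sen (f ∘ T) X ≡ sen f (T X).  It
-- does not preserve the numerical order of words; but at a distance j ≥ 1 the
-- pairs with X < Y are exactly half of all ordered pairs, and the count of
-- ordered pairs is invariant.  Negating the output leaves sensitivities
-- unchanged and exchanges the two level sets.
module Submission where

open import Defs
open import Data.Bool using (Bool; true; false; not; if_then_else_)
open import Data.Bool.Properties using (not-involutive; not-injective) renaming (_≟_ to _≟ᵇ_)
open import Data.Empty using (⊥-elim)
open import Data.Fin using (Fin; zero; suc; toℕ)
open import Data.Fin.Permutation using (Permutation′; _⟨$⟩ʳ_; _⟨$⟩ˡ_; inverseʳ; inverseˡ)
open import Data.Fin.Properties using () renaming (_≟_ to _≟ᶠ_)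
open import Data.Fin.Subset using (Subset)
open import Data.List using (List; []; _∷_; map; length; allFin; cartesianProduct)
open import Data.List.Membership.Propositional using (_∈_)
open import Data.List.Membership.Propositional.Properties using (∈-map⁺; ∈-allFin; ∈-cartesianProduct⁺)
open import Data.List.Membership.Propositional.Properties.WithK using (unique∧set⇒bag)
open import Data.List.Properties using (filter-≐; filter-none)
open import Data.List.Relation.Binary.BagAndSetEquality using (∼bag⇒↭)
open import Data.List.Relation.Binary.Permutation.Propositional using (_↭_)
open import Data.List.Relation.Binary.Permutation.Propositional.Properties using (↭-length; filter-↭)
open import Data.List.Relation.Unary.All using (universal)
open import Data.List.Relation.Unary.Unique.Propositional using (Unique)
open import Data.List.Relation.Unary.Unique.Propositional.Properties using (map⁺; allFin⁺; cartesianProduct⁺)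
open import Data.Nat using (ℕ; zero; suc; _+_; _^_; _<_; ⌊_/2⌋)
open import Data.Nat.Properties using (_≟_; _<?_; +-suc; +-identityʳ; +-cancelˡ-≡; +-monoʳ-<; <-asym; <-cmp; <⇒≱; m≤m+n; ≤-trans; ≤-reflexive; n≡⌊n+n/2⌋; m^n>0; m≤n⇒m≤n+o)
open import Data.Product using (_×_; _,_; proj₁; proj₂; swap)
open import Data.Product.Function.NonDependent.Propositional using (_×-↔_)
open import Data.Sum using (_⊎_; inj₁; inj₂; [_,_]′)
open import Data.Vec using ([]; _∷_; lookup)
open import Data.Vec.Properties using (lookup∘tabulate; tabulate∘lookup; tabulate-cong; lookup-zipWith; lookup∘updateAt; lookup∘updateAt′)
open import Function using (_∘_; id; _↔_; Inverse; mk⇔; mk↔ₛ′)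
open import Function.Properties.Inverse using (↔-sym)
open import Level using (Level)
open import Relation.Binary using (tri<; tri≈; tri>)
open import Relation.Binary.PropositionalEquality using (_≡_; _≗_; refl; sym; trans; cong; cong₂; subst; module ≡-Reasoning)
open import Relation.Nullary using (¬_; ¬?; yes; no; does; _×-dec_; contradiction)
open import Relation.Unary using (Pred; Decidable; _≐_; _∪_)

private
  variable
    a p q r : Level
    A B : Set a
    n : ℕ

-- Counting

count-≐ : {P : Pred A p} {Q : Pred A q} (P? : Decidable P) (Q? : Decidable Q) →
  P ≐ Q → ∀ xs → count P? xs ≡ count Q? xs
count-≐ P? Q? P≐Q xs = cong length (filter-≐ P? Q? P≐Q xs)

count-map : {P : Pred B p} (P? : Decidable P) (h : A → B) →
  ∀ xs → count P? (map h xs) ≡ count (P? ∘ h) xs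
count-map P? h []       = refl
count-map P? h (x ∷ xs) with does (P? (h x))
... | true  = cong suc (count-map P? h xs)
... | false = count-map P? h xs

-- Each element satisfying `P` adds one to exactly one of the two counts on the right. This will
-- split the pairs at a fixed positive distance into ascending and descending ones.
count-disjoint-∪ : {P : Pred A p} {Q : Pred A q} {R : Pred A r}
  (P? : Decidable P) (Q? : Decidable Q) (R? : Decidable R) →
  P ≐ Q ∪ R → (∀ {x} → Q x → ¬ R x) →
  ∀ xs → count P? xs ≡ count Q? xs + count R? xs
count-disjoint-∪ P? Q? R? P≐Q∪R disj [] = refl
count-disjoint-∪ P? Q? R? P≐Q∪R@(split , join) disj (x ∷ xs)
  with ih ← count-disjoint-∪ P? Q? R? P≐Q∪R disj xs | P? x | Q? x | R? x
... | _     | yes Qx | yes Rx = contradiction Rx (disj Qx)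
... | yes _ | yes _  | no _   = cong suc ih
... | yes _ | no _   | yes _  = trans (cong suc ih) (sym (+-suc _ _))
... | yes Px | no ¬Qx | no ¬Rx = ⊥-elim ([ ¬Qx , ¬Rx ]′ (split Px))
... | no ¬Px | yes Qx | no _   = contradiction (join (inj₁ Qx)) ¬Px
... | no ¬Px | no _   | yes Rx = contradiction (join (inj₂ Rx)) ¬Px
... | no _   | no _   | no _   = ih

module _ {xs : List A} (complete : ∀ x → x ∈ xs) (unique : Unique xs) (e : A ↔ A) where
  open Inverse e

  -- Both lists are free of duplicates and contain every element, `x` being the image of `from x`;
  -- such lists agree as bags.
  map-↔-↭ : map to xs ↭ xs
  map-↔-↭ = ∼bag⇒↭ (unique∧set⇒bag (map⁺ to-injective unique) unique
    (mk⇔ (λ _ → complete _)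
         (λ _ → subst (_∈ map to xs) (strictlyInverseˡ _) (∈-map⁺ to (complete _)))))
    where
    to-injective : ∀ {x y} → to x ≡ to y → x ≡ y
    to-injective eq = trans (sym (strictlyInverseʳ _)) (trans (cong from eq) (strictlyInverseʳ _))

  -- Change of variables in a count over a whole finite type. It is applied to positions along `π`,
  -- and to pairs of words along the swap and along the cube automorphism.
  count-reindex : {P : Pred A p} {Q : Pred A q} (P? : Decidable P) (Q? : Decidable Q) →
    P ∘ to ≐ Q → count P? xs ≡ count Q? xs
  count-reindex P? Q? P∘to≐Q = begin
    count P? xs          ≡⟨ ↭-length (filter-↭ P? map-↔-↭) ⟨
    count P? (map to xs) ≡⟨ count-map P? to xs ⟩
    count (P? ∘ to) xs   ≡⟨ count-≐ (P? ∘ to) Q? P∘to≐Q xs ⟩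
    count Q? xs          ∎
    where open ≡-Reasoning

count-allFin-reindex : {P : Pred (Fin n) p} {Q : Pred (Fin n) q}
  (P? : Decidable P) (Q? : Decidable Q) (π : Permutation′ n) →
  P ∘ (π ⟨$⟩ʳ_) ≐ Q → count P? (allFin n) ≡ count Q? (allFin n)
count-allFin-reindex P? Q? π = count-reindex ∈-allFin (allFin⁺ _) π P? Q?

wordPairs : ∀ n → List (Word n × Word n)
wordPairs n = cartesianProduct (words n) (words n)

count-wordPairs-reindex : {P : Pred (Word n × Word n) p} {Q : Pred (Word n × Word n) q}
  (P? : Decidable P) (Q? : Decidable Q) (e : (Word n × Word n) ↔ (Word n × Word n)) →
  P ∘ Inverse.to e ≐ Q → count P? (wordPairs n) ≡ count Q? (wordPairs n)
count-wordPairs-reindex P? Q? e =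
  count-reindex (λ (X , Y) → ∈-cartesianProduct⁺ (words-complete X) (words-complete Y))
    (cartesianProduct⁺ (words-unique _) (words-unique _)) e P? Q?

-- The cube {0,1}ⁿ and its automorphisms

lookup-ext : {X Y : Word n} → lookup X ≗ lookup Y → X ≡ Y
lookup-ext {X = X} {Y} eq =
  trans (sym (tabulate∘lookup X)) (trans (tabulate-cong eq) (tabulate∘lookup Y))

negateIf : Bool → Bool → Bool
negateIf s x = if s then not x else x

negateIf-involutive : ∀ s x → negateIf s (negateIf s x) ≡ x
negateIf-involutive true  x = not-involutive x
negateIf-involutive false x = refl

negateIf-injective : ∀ s {x y} → negateIf s x ≡ negateIf s y → x ≡ y
negateIf-injective true  = not-injective
negateIf-injective false = id

negateIf-not : ∀ s x → negateIf s (not x) ≡ not (negateIf s x)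
negateIf-not true  x = refl
negateIf-not false x = refl

selectiveNegation-involutive : (S : Subset n) (X : Word n) →
  selectiveNegation S (selectiveNegation S X) ≡ X
selectiveNegation-involutive []      []      = refl
selectiveNegation-involutive (s ∷ S) (x ∷ X) =
  cong₂ _∷_ (negateIf-involutive s x) (selectiveNegation-involutive S X)

selectiveNegation-flip : (S : Subset n) (X : Word n) (i : Fin n) →
  selectiveNegation S (flip X i) ≡ flip (selectiveNegation S X) i
selectiveNegation-flip (s ∷ S) (x ∷ X) zero    = cong (_∷ _) (negateIf-not s x)
selectiveNegation-flip (s ∷ S) (x ∷ X) (suc i) = cong (_ ∷_) (selectiveNegation-flip S X i)

-- `permute` precomposes with the permutation, so composites reverse: the hypothesis concerns `ρ`
-- after `π`.
permute-inverse : (π ρ : Permutation′ n) → (∀ i → ρ ⟨$⟩ʳ (π ⟨$⟩ʳ i) ≡ i) →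
  (X : Word n) → permute π (permute ρ X) ≡ X
permute-inverse π ρ inv X = lookup-ext λ i → begin
  lookup (permute π (permute ρ X)) i    ≡⟨ lookup∘tabulate _ i ⟩
  lookup (permute ρ X) (π ⟨$⟩ʳ i)       ≡⟨ lookup∘tabulate _ (π ⟨$⟩ʳ i) ⟩
  lookup X (ρ ⟨$⟩ʳ (π ⟨$⟩ʳ i))          ≡⟨ cong (lookup X) (inv i) ⟩
  lookup X i                            ∎
  where open ≡-Reasoning

-- Entry `i` of the permuted word is read from position `π i`, and by injectivity of `π` no other
-- entry is.
permute-flip : (π : Permutation′ n) (X : Word n) (i : Fin n) →
  permute π (flip X (π ⟨$⟩ʳ i)) ≡ flip (permute π X) i
permute-flip π X i = lookup-ext λ k → trans (lookup∘tabulate _ k) (pointwise k)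
  where
  pointwise : ∀ k → lookup (flip X (π ⟨$⟩ʳ i)) (π ⟨$⟩ʳ k) ≡ lookup (flip (permute π X) i) k
  pointwise k with k ≟ᶠ i
  ... | yes refl = trans (lookup∘updateAt (π ⟨$⟩ʳ i) X)
    (sym (trans (lookup∘updateAt i (permute π X)) (cong not (lookup∘tabulate _ i))))
  ... | no k≢i = trans (lookup∘updateAt′ _ _ (k≢i ∘ π-injective) X)
    (sym (trans (lookup∘updateAt′ k i k≢i (permute π X)) (lookup∘tabulate _ k)))
    where
    π-injective : π ⟨$⟩ʳ k ≡ π ⟨$⟩ʳ i → k ≡ i
    π-injective eq = trans (sym (inverseˡ π)) (trans (cong (π ⟨$⟩ˡ_) eq) (inverseˡ π))

module _ (π : Permutation′ n) (S : Subset n) where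

  transform : Word n → Word n
  transform X = permute π (selectiveNegation S X)

  transform-↔ : Word n ↔ Word n
  transform-↔ = mk↔ₛ′ transform (selectiveNegation S ∘ permute (↔-sym π))
    (λ X → trans (cong (permute π) (selectiveNegation-involutive S _))
                 (permute-inverse π (↔-sym π) (λ _ → inverseˡ π) X))
    (λ X → trans (cong (selectiveNegation S)
                       (permute-inverse (↔-sym π) π (λ _ → inverseʳ π) _))
                 (selectiveNegation-involutive S X))

  transform-flip : ∀ X i → transform (flip X (π ⟨$⟩ʳ i)) ≡ flip (transform X) i
  transform-flip X i =
    trans (cong (permute π) (selectiveNegation-flip S X _)) (permute-flip π (selectiveNegation S X) i)

  lookup-transform : ∀ X i →
    lookup (transform X) i ≡ negateIf (lookup S (π ⟨$⟩ʳ i)) (lookup X (π ⟨$⟩ʳ i))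
  lookup-transform X i = trans (lookup∘tabulate _ i) (lookup-zipWith _ (π ⟨$⟩ʳ i) S X)

  -- At each position both words pass through the same injective map `negateIf s`, so `π` carries
  -- the positions where the images differ onto those where `X` and `Y` differ.
  hamming-transform : ∀ X Y → hamming (transform X) (transform Y) ≡ hamming X Y
  hamming-transform X Y = sym (count-allFin-reindex _ _ π
    ( (λ {i} X≢Y eq → X≢Y (negateIf-injective (lookup S (π ⟨$⟩ʳ i))
        (trans (sym (lookup-transform X i)) (trans eq (lookup-transform Y i)))))
    , (λ {i} TX≢TY eq → TX≢TY (trans (lookup-transform X i)
        (trans (cong (negateIf _) eq) (sym (lookup-transform Y i)))))))

  -- Edges in direction `π i` at `X` go to edges in direction `i` at the image, so `i` is sensitive
  -- for `f` there exactly when `π i` is sensitive for `g` at `X`.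
  sen-transform : ∀ {f g : BooleanFunction n} → f ∘ transform ≗ g →
    ∀ X → sen f (transform X) ≡ sen g X
  sen-transform {f} {g} f∘T≗g X = sym (count-allFin-reindex _ _ π
    ( (λ g≢ eq → g≢ (trans (sym (f∘T≗g X)) (trans eq (sym (step _)))))
    , (λ f≢ eq → f≢ (trans (f∘T≗g X) (trans eq (step _))))))
    where
    step : ∀ i → g (flip X (π ⟨$⟩ʳ i)) ≡ f (flip (transform X) i)
    step i = trans (sym (f∘T≗g _)) (cong f (transform-flip X i))

-- Unordered pairs of words

binary<2^n : (X : Word n) → binary X < 2 ^ n
binary<2^n []          = m^n>0 2 0
binary<2^n {suc n} (false ∷ X) = m≤n⇒m≤n+o _ (binary<2^n X)
binary<2^n {suc n} (true ∷ X)  =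
  -- `2 ^ suc n` unfolds to `2 ^ n + (2 ^ n + 0)`; the `subst` accounts for the trailing zero.
  +-monoʳ-< (2 ^ n) (subst (binary X <_) (sym (+-identityʳ _)) (binary<2^n X))

binary-injective : (X Y : Word n) → binary X ≡ binary Y → X ≡ Y
binary-injective []          []          _  = refl
binary-injective (false ∷ X) (false ∷ Y) eq = cong (false ∷_) (binary-injective X Y eq)
binary-injective (true ∷ X)  (true ∷ Y)  eq =
  cong (true ∷_) (binary-injective X Y (+-cancelˡ-≡ _ _ _ eq))
-- With different leading bits, one value is at least `2 ^ n` and the other is below it.
binary-injective (false ∷ X) (true ∷ Y)  eq =
  contradiction (≤-trans (m≤m+n _ _) (≤-reflexive (sym eq))) (<⇒≱ (binary<2^n X))
binary-injective (true ∷ X)  (false ∷ Y) eq =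
  contradiction (≤-trans (m≤m+n _ _) (≤-reflexive eq)) (<⇒≱ (binary<2^n Y))

hamming-refl : (X : Word n) → hamming X X ≡ 0
hamming-refl {n} X = cong length
  (filter-none (λ i → ¬? (lookup X i ≟ᵇ lookup X i)) (universal (λ _ ≢ → ≢ refl) (allFin n)))

hamming-sym : (X Y : Word n) → hamming X Y ≡ hamming Y X
hamming-sym {n} X Y = count-≐ _ _ ((λ X≢Y Y≡X → X≢Y (sym Y≡X)) , (λ Y≢X X≡Y → Y≢X (sym X≡Y))) (allFin n)

module _ {P : Pred (Word n) p} (P? : Decidable P) (j : ℕ) where

  orderedCount : ℕ
  orderedCount = count (λ (X , Y) → P? X ×-dec P? Y ×-dec (hamming X Y ≟ j)) (wordPairs n)

  -- Generic in `P` to cover both vectors: `δ` is by definition the instance with prescribed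
  -- sensitivity, and `δᵇ` also prescribes the value of the function.
  unorderedCount : ℕ
  unorderedCount = count (λ (X , Y) → P? X ×-dec P? Y ×-dec (hamming X Y ≟ j)
                                      ×-dec (binary X <? binary Y)) (wordPairs n)

-- At positive distance the two words are distinct, so each ordered pair is either ascending or
-- descending, and swapping matches the two kinds. On the diagonal, at distance 0, this fails; hence
-- `suc j`.
orderedCount-double : {P : Pred (Word n) p} (P? : Decidable P) (j : ℕ) →
  orderedCount P? (suc j) ≡ unorderedCount P? (suc j) + unorderedCount P? (suc j)
orderedCount-double {n = n} {P = P} P? j = trans
  (count-disjoint-∪ _ _ descending? (split , join)
    (λ (_ , _ , _ , X<Y) (_ , _ , _ , Y<X) → <-asym X<Y Y<X) (wordPairs n))
  (cong (unorderedCount P? (suc j) +_)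
    (count-wordPairs-reindex descending? _ (mk↔ₛ′ swap swap (λ _ → refl) (λ _ → refl))
      (symmetric , symmetric)))
  where
  descending? : Decidable (λ (X , Y) → P X × P Y × hamming X Y ≡ suc j × binary Y < binary X)
  descending? (X , Y) = P? X ×-dec P? Y ×-dec (hamming X Y ≟ suc j) ×-dec (binary Y <? binary X)

  split : ∀ {(X , Y) : Word n × Word n} → P X × P Y × hamming X Y ≡ suc j →
    (P X × P Y × hamming X Y ≡ suc j × binary X < binary Y) ⊎
    (P X × P Y × hamming X Y ≡ suc j × binary Y < binary X)
  split {X , Y} (PX , PY , h) with <-cmp (binary X) (binary Y)
  ... | tri< X<Y _ _ = inj₁ (PX , PY , h , X<Y)
  ... | tri> _ _ Y<X = inj₂ (PX , PY , h , Y<X)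
  -- Equal binary values force equal words, whose distance is 0 and not `suc j`.
  ... | tri≈ _ eq _ with refl ← binary-injective X Y eq =
    contradiction (trans (sym (hamming-refl X)) h) λ ()

  join : ∀ {(X , Y) : Word n × Word n} →
    (P X × P Y × hamming X Y ≡ suc j × binary X < binary Y) ⊎
    (P X × P Y × hamming X Y ≡ suc j × binary Y < binary X) →
    P X × P Y × hamming X Y ≡ suc j
  join (inj₁ (PX , PY , h , _)) = PX , PY , h
  join (inj₂ (PX , PY , h , _)) = PX , PY , h

  -- After the swap the descending condition reads literally as the ascending one, so it is carried
  -- along as an arbitrary `L`. Exchanging `X` and `Y` gives the converse direction.
  symmetric : ∀ {X Y : Word n} {L : Set} →
    P Y × P X × hamming Y X ≡ suc j × L → P X × P Y × hamming X Y ≡ suc j × L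
  symmetric {X} {Y} (PY , PX , h , l) = PX , PY , trans (hamming-sym X Y) h , l

-- The automorphism may reverse the order within a pair, so the comparison is made on ordered pairs;
-- halving then undoes the doubling.
unorderedCount-transform : (π : Permutation′ n) (S : Subset n)
  {P : Pred (Word n) p} {Q : Pred (Word n) q} (P? : Decidable P) (Q? : Decidable Q) →
  P ∘ transform π S ≐ Q → ∀ j → unorderedCount P? (suc j) ≡ unorderedCount Q? (suc j)
unorderedCount-transform π S P? Q? (P⇒Q , Q⇒P) j = begin
  unorderedCount P? (suc j)                                 ≡⟨ n≡⌊n+n/2⌋ _ ⟩
  ⌊ unorderedCount P? (suc j) + unorderedCount P? (suc j) /2⌋ ≡⟨ cong ⌊_/2⌋ (orderedCount-double P? j) ⟨
  ⌊ orderedCount P? (suc j) /2⌋                             ≡⟨ cong ⌊_/2⌋ ordered ⟩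
  ⌊ orderedCount Q? (suc j) /2⌋                             ≡⟨ cong ⌊_/2⌋ (orderedCount-double Q? j) ⟩
  ⌊ unorderedCount Q? (suc j) + unorderedCount Q? (suc j) /2⌋ ≡⟨ n≡⌊n+n/2⌋ _ ⟨
  unorderedCount Q? (suc j)                                 ∎
  where
  open ≡-Reasoning
  ordered : orderedCount P? (suc j) ≡ orderedCount Q? (suc j)
  ordered = count-wordPairs-reindex _ _ (transform-↔ π S ×-↔ transform-↔ π S)
    ( (λ {(X , Y)} (PX , PY , h) →
        P⇒Q PX , P⇒Q PY , trans (sym (hamming-transform π S X Y)) h)
    , (λ {(X , Y)} (QX , QY , h) →
        Q⇒P QX , Q⇒P QY , trans (hamming-transform π S X Y) h))

-- Invariance of the sensitivity distance vectors

sensitivity? : (f : BooleanFunction n) (i : ℕ) → Decidable (λ X → sen f X ≡ i)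
sensitivity? f i X = sen f X ≟ i

levelSensitivity? : (b : Bool) (f : BooleanFunction n) (i : ℕ) →
  Decidable (λ X → f X ≡ b × sen f X ≡ i)
levelSensitivity? b f i X = (f X ≟ᵇ b) ×-dec (sen f X ≟ i)

-- Only a regrouping of the conjuncts, collecting the conditions on each word into one predicate.
δᵇ-unorderedCount : ∀ b (f : BooleanFunction n) i j →
  δᵇ b f i j ≡ unorderedCount (levelSensitivity? b f i) j
δᵇ-unorderedCount {n} b f i j = count-≐ _ _
  ( (λ (fX , fY , sX , sY , rest) → (fX , sX) , (fY , sY) , rest)
  , (λ ((fX , sX) , (fY , sY) , rest) → fX , fY , sX , sY , rest)) (wordPairs n)

module _ {f g : BooleanFunction n} (f≈g : PNEquivalent f g) where
  private
    π = proj₁ f≈g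
    S = proj₁ (proj₂ f≈g)
    f∘T≗g = proj₂ (proj₂ f≈g)

    sen-f∘T : ∀ X → sen f (transform π S X) ≡ sen g X
    sen-f∘T = sen-transform π S {f} {g} f∘T≗g

  δ-PN : ∀ i j → δ f i (suc j) ≡ δ g i (suc j)
  δ-PN i = unorderedCount-transform π S (sensitivity? f i) (sensitivity? g i)
    ((λ {X} → trans (sym (sen-f∘T X))) , (λ {X} → trans (sen-f∘T X)))

  δᵇ-PN : ∀ b i j → δᵇ b f i (suc j) ≡ δᵇ b g i (suc j)
  δᵇ-PN b i j = begin
    δᵇ b f i (suc j)                                 ≡⟨ δᵇ-unorderedCount b f i (suc j) ⟩
    unorderedCount (levelSensitivity? b f i) (suc j) ≡⟨ unorderedCount-transform π S
      (levelSensitivity? b f i) (levelSensitivity? b g i)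
      ( (λ {X} (fX , sX) → trans (sym (f∘T≗g X)) fX , trans (sym (sen-f∘T X)) sX)
      , (λ {X} (gX , sX) → trans (f∘T≗g X) gX , trans (sen-f∘T X) sX)) j ⟩
    unorderedCount (levelSensitivity? b g i) (suc j) ≡⟨ δᵇ-unorderedCount b g i (suc j) ⟨
    δᵇ b g i (suc j)                                 ∎
    where open ≡-Reasoning

  OSDV-PN : OSDV f ≡ OSDV g
  OSDV-PN = tabulate-cong λ i → tabulate-cong λ j → δ-PN (toℕ i) (toℕ j)

  OSDVᵇ-PN : ∀ b → OSDVᵇ b f ≡ OSDVᵇ b g
  OSDVᵇ-PN b = tabulate-cong λ i → tabulate-cong λ j → δᵇ-PN b (toℕ i) (toℕ j)

-- Negation of the output

sen-not : (f : BooleanFunction n) (X : Word n) → sen (not ∘ f) X ≡ sen f X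
sen-not {n} f X =
  count-≐ _ _ ((λ ¬f≢ eq → ¬f≢ (cong not eq)) , (λ f≢ eq → f≢ (not-injective eq))) (allFin n)

-- Since `not` is injective, the level set of `f` at `b` is that of its negation at `not b`, with
-- the same sensitivities.
δᵇ-not : ∀ b (f : BooleanFunction n) i j → δᵇ (not b) (not ∘ f) i j ≡ δᵇ b f i j
δᵇ-not {n} b f i j = count-≐ _ _
  ( (λ {(X , Y)} (fX , fY , sX , sY , rest) →
      not-injective fX , not-injective fY ,
      trans (sym (sen-not f X)) sX , trans (sym (sen-not f Y)) sY , rest)
  , (λ {(X , Y)} (fX , fY , sX , sY , rest) →
      cong not fX , cong not fY ,
      trans (sen-not f X) sX , trans (sen-not f Y) sY , rest)) (wordPairs n)

OSDVᵇ-not : ∀ b (f : BooleanFunction n) → OSDVᵇ (not b) (not ∘ f) ≡ OSDVᵇ b f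
OSDVᵇ-not b f = tabulate-cong λ i → tabulate-cong λ j → δᵇ-not b f (toℕ i) (suc (toℕ j))

theorem4 : ∀ (n : ℕ) (f g : BooleanFunction n) →
    (Unbalanced f → Unbalanced g → PNEquivalent f g →
    OSDV f ≡ OSDV g × OSDVᵇ false f ≡ OSDVᵇ false g × OSDVᵇ true f ≡ OSDVᵇ true g)
    ×
    (Balanced f → Balanced g → NPNEquivalent f g →
    (OSDVᵇ true f ≡ OSDVᵇ true g × OSDVᵇ false f ≡ OSDVᵇ false g)
    ⊎
    (OSDVᵇ true f ≡ OSDVᵇ false g × OSDVᵇ false f ≡ OSDVᵇ true g))
theorem4 n f g = (λ _ _ f≈g → OSDV-PN f≈g , OSDVᵇ-PN f≈g false , OSDVᵇ-PN f≈g true) , npn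
  where
  npn : Balanced f → Balanced g → NPNEquivalent f g →
    (OSDVᵇ true f ≡ OSDVᵇ true g × OSDVᵇ false f ≡ OSDVᵇ false g) ⊎
    (OSDVᵇ true f ≡ OSDVᵇ false g × OSDVᵇ false f ≡ OSDVᵇ true g)
  npn _ _ (π , S , inj₁ eq) = inj₁ (OSDVᵇ-PN f≈g true , OSDVᵇ-PN f≈g false)
    where
    f≈g : PNEquivalent f g
    f≈g = π , S , eq
  -- Here the negation of `f` is PN-equivalent to `g`. Passing from `f` to its negation exchanges
  -- the level sets, which gives the crossed equalities.
  npn _ _ (π , S , inj₂ eq) = inj₂
    ( trans (sym (OSDVᵇ-not true f)) (OSDVᵇ-PN ¬f≈g false)
    , trans (sym (OSDVᵇ-not false f)) (OSDVᵇ-PN ¬f≈g true))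
    where
    ¬f≈g : PNEquivalent (not ∘ f) g
    ¬f≈g = π , S , eq
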